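{- Let $d\ge4$ and suppose the graph $G$ on $n$ vertices contains the complete graph $K_d$ as a subgraph. Then there are $c_d>0$ and $\ell_0(d)$, depending only on $d$ (independent of $G$ and $n$), with $$\mathrm{Ev}_\ell(G)\ge c_d\,(d-2)^\ell\quad\text{for all even }\ell\ge\ell_0(d).$$ Since $d-2>\sqrt{d-1}$ for every $d\ge4$, there is a constant $C_d$ depending only on $d$ such that $\mathrm{Ev}_\ell(G)$, and hence the confined mass $\sum_{z\in W}N^{\mathrm{nb}}_\ell(z)$ for every subspace $W$ of the cycle space of $G$, exceeds $n(\sqrt{d-1})^\ell$ for all even $\ell\ge C_d\log n$.
   Context: $G=(V,E)$ is a finite simple connected graph. A closed non-backtracking walk of length $\ell$ is a sequence of directed edges $(e_1,\dots,e_\ell)$ with head of $e_i$ equal to tail of $e_{i+1}$ and $e_{i+1}\ne\bar e_i$ for all $i$ modulo $\ell$ ($\bar e$ the reversal of $e$; the starting directed edge is marked). It is totally even if every undirected edge is traversed an even number of times; $\mathrm{Ev}_\ell(G)$ is the number of totally even closed non-backtracking walks of length $\ell$ in $G$. $N^{\mathrm{nb}}_\ell(z)$ is the number of closed non-backtracking walks of length $\ell$ whose vector of edge traversal multiplicities modulo $2$ equals $z\in\mathbb F_2^E$; thus $\mathrm{Ev}_\ell=N^{\mathrm{nb}}_\ell(0)$. -}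

module Defs where

open import Data.Bool using (if_then_else_)
open import Data.Fin as Fin using (Fin; toℕ)
import Data.Fin.Properties as Fin
open import Data.Integer using (+_)
open import Data.List as List using (List; []; _∷_; length; map; filter)
open import Data.Nat using (ℕ; zero; suc; _*_; _^_; _≤_; _<_; parity)
open import Data.Nat.ListAction using (sum)
open import Data.Nat.Divisibility using (_∣_; _∣?_)
open import Data.Nat.DivMod using (_mod_)
open import Data.Parity.Base as ℙ using (0ℙ; 1ℙ)
open import Data.Parity.Properties as ℙ using ()
open import Data.Product using (_×_; _,_; ∃; proj₁; proj₂; swap)
open import Data.Product.Properties as × using ()
open import Data.Rational as ℚ using (ℚ)
open import Data.Vec as Vec using (Vec; lookup; tabulate; replicate; zipWith)
open import Data.Vec.Properties as Vec using ()
open import Function.Base using (_∘_)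
open import Function.Definitions using (Injective)
open import Level using (0ℓ)
open import Relation.Binary using (Rel; Decidable; DecidableEquality; Symmetric; Irreflexive)
open import Relation.Binary.Construct.Closure.ReflexiveTransitive using (Star)
open import Relation.Binary.PropositionalEquality using (_≡_; _≢_; sym)
open import Relation.Nullary using (does; ¬?)
open import Relation.Nullary.Decidable using (_×-dec_; _⊎-dec_)
open import Relation.Unary using (Pred) renaming (Decidable to Decidable₁)

record Graph (n : ℕ) : Set₁ where
  field
    Adj    : Rel (Fin n) 0ℓ
    adj?   : Decidable Adj
    adjSym : Symmetric Adj
    irrefl : Irreflexive _≡_ Adj

open Graph public

Connected : ∀ {n} → Graph n → Set
Connected G = ∀ u v → Star (Adj G) u v

complete : ∀ d → Graph d
complete d = record
  { Adj    = _≢_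
  ; adj?   = λ u v → ¬? (u Fin.≟ v)
  ; adjSym = λ u≢v → u≢v ∘ sym
  ; irrefl = λ u≡v u≢v → u≢v u≡v
  }

-- Not necessarily as an induced subgraph.
_ContainedIn_ : ∀ {m n} → Graph m → Graph n → Set
_ContainedIn_ {m} {n} H G =
  ∃ λ (f : Fin m → Fin n) →
    Injective _≡_ _≡_ f × (∀ {u v} → Adj H u v → Adj G (f u) (f v))

tuples : ∀ {A : Set} → List A → (k : ℕ) → List (Vec A k)
tuples xs zero    = Vec.[] ∷ []
tuples xs (suc k) = List.cartesianProductWith Vec._∷_ xs (tuples xs k)

-- i ↦ i + 1 modulo k.
next : ∀ {k} → Fin k → Fin k
next {suc k} i = suc (toℕ i) mod suc k

-- The pair (u , v) is the directed edge with tail u and head v, so that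
-- swap is edge reversal.
Dart : ℕ → Set
Dart n = Fin n × Fin n

tail head : ∀ {n} → Dart n → Fin n
tail = proj₁
head = proj₂

_≟ᵈ_ : ∀ {n} → DecidableEquality (Dart n)
_≟ᵈ_ = ×.≡-dec Fin._≟_ Fin._≟_

darts : ∀ {n} → Graph n → List (Dart n)
darts {n} G =
  filter (λ e → adj? G (tail e) (head e))
         (List.cartesianProduct (List.allFin n) (List.allFin n))

-- The undirected edge {u , v} is represented by its orientation from the
-- smaller to the larger endpoint.
edges : ∀ {n} → Graph n → List (Dart n)
edges G = filter (λ e → tail e Fin.<? head e) (darts G)

∣E∣ : ∀ {n} → Graph n → ℕ
∣E∣ G = length (edges G)

edge : ∀ {n} (G : Graph n) → Fin (∣E∣ G) → Dart n
edge G = List.lookup (edges G)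

ClosedNB : ∀ {n ℓ} → Pred (Vec (Dart n) ℓ) 0ℓ
ClosedNB w = ∀ i →
  head (lookup w i) ≡ tail (lookup w (next i)) ×
  lookup w (next i) ≢ swap (lookup w i)

closedNB? : ∀ {n ℓ} → Decidable₁ (ClosedNB {n} {ℓ})
closedNB? w = Fin.all? λ i →
  (head (lookup w i) Fin.≟ tail (lookup w (next i))) ×-dec
  ¬? (lookup w (next i) ≟ᵈ swap (lookup w i))

closedNBWalks : ∀ {n} → Graph n → (ℓ : ℕ) → List (Vec (Dart n) ℓ)
closedNBWalks G ℓ = filter closedNB? (tuples (darts G) ℓ)

-- The number of traversals, in either direction, of the undirected edge
-- underlying e.
multiplicity : ∀ {n ℓ} → Dart n → Vec (Dart n) ℓ → ℕ
multiplicity e = Vec.count λ a → (a ≟ᵈ e) ⊎-dec (a ≟ᵈ swap e)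

TotallyEven : ∀ {n} → Graph n → ∀ {ℓ} → Pred (Vec (Dart n) ℓ) 0ℓ
TotallyEven G w = ∀ i → 2 ∣ multiplicity (edge G i) w

totallyEven? : ∀ {n} (G : Graph n) {ℓ} → Decidable₁ (TotallyEven G {ℓ})
totallyEven? G w = Fin.all? λ i → 2 ∣? multiplicity (edge G i) w

Ev : ∀ {n} → Graph n → ℕ → ℕ
Ev G ℓ = length (filter (totallyEven? G) (closedNBWalks G ℓ))

-- ℙ.Parity, with its addition and multiplication, is the field 𝔽₂.
EdgeVec : ∀ {n} → Graph n → Set
EdgeVec G = Vec ℙ.Parity (∣E∣ G)

edgeVecs : ∀ {n} (G : Graph n) → List (EdgeVec G)
edgeVecs G = tuples (0ℙ ∷ 1ℙ ∷ []) (∣E∣ G)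

parityVec : ∀ {n} (G : Graph n) {ℓ} → Vec (Dart n) ℓ → EdgeVec G
parityVec G w = tabulate λ i → parity (multiplicity (edge G i) w)

Nnb : ∀ {n} (G : Graph n) → ℕ → EdgeVec G → ℕ
Nnb G ℓ z =
  length (filter (λ w → Vec.≡-dec ℙ._≟_ (parityVec G w) z) (closedNBWalks G ℓ))

-- The coordinate at v of the boundary of z: the sum of z over the edges
-- incident with v.
boundary : ∀ {n} (G : Graph n) → EdgeVec G → Fin n → ℙ.Parity
boundary G z v = Vec.foldr (λ _ → ℙ.Parity) ℙ._+_ 0ℙ (tabulate λ i →
  if does ((v Fin.≟ tail (edge G i)) ⊎-dec (v Fin.≟ head (edge G i)))
  then lookup z i else 0ℙ)

CycleSpace : ∀ {n} (G : Graph n) → Pred (EdgeVec G) 0ℓ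
CycleSpace G z = ∀ v → boundary G z v ≡ 0ℙ

-- Membership is decidable so that sums over the subspace can be formed;
-- classically this is no restriction, the edge space being finite.
record CycleSubspace {n} (G : Graph n) : Set₁ where
  field
    Mem      : Pred (EdgeVec G) 0ℓ
    mem?     : Decidable₁ Mem
    ⊆cycles  : ∀ {z} → Mem z → CycleSpace G z
    0∈       : Mem (replicate _ 0ℙ)
    +-closed : ∀ {y z} → Mem y → Mem z → Mem (zipWith ℙ._+_ y z)
    *-closed : ∀ a {z} → Mem z → Mem (Vec.map (a ℙ.*_) z)

open CycleSubspace public

confinedMass : ∀ {n} (G : Graph n) → CycleSubspace G → ℕ → ℕ
confinedMass G W ℓ = sum (map (Nnb G ℓ) (filter (mem? W) (edgeVecs G)))

fromℕ : ℕ → ℚ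
fromℕ k = + k ℚ./ 1

-- x > m (√a)^ℓ: both sides are nonnegative, so they may be squared.
_>_·√_^_ : (x m a ℓ : ℕ) → Set
x > m ·√ a ^ ℓ = m * m * (a ^ ℓ) < x * x

-- ℓ ≥ C log₂ n, for n ≥ 1: both sides are exponentiated with base 2.  For
-- an unspecified constant C, the base of the logarithm is immaterial.
_≥_·log₂_ : (ℓ C n : ℕ) → Set
ℓ ≥ C ·log₂ n = n ^ C ≤ 2 ^ ℓ

{-# OPTIONS --safe #-}

-- Fix a directed edge a of K_d.  Each of the (d-2)^m non-backtracking walks of
-- length m continuing a can be closed up to a loop at a by five further edges.
-- There are at most 2^(d²) parity patterns, so a proportion of the loops,
-- depending only on d, share one pattern.  Concatenating any two of these is a
-- closed non-backtracking walk, because both begin with a, and it is totally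
-- even.  That gives at least ((d-2)^m)² / 4^(d²) such walks of length 2(m+6).
module Submission where

open import Defs
open import Data.Bool using (true; false)
open import Data.Fin as Fin using (Fin; zero; suc; toℕ; inject₁; punchIn; punchOut)
import Data.Fin.Properties as Fin
open import Data.Fin.Relation.Unary.Top using (view; ‵fromℕ; ‵inject₁)
open import Data.Integer as ℤ using (+_)
import Data.Integer.Properties as ℤ
open import Data.List as List using (List; []; _∷_; length; filter)
open import Data.List.Properties using (length-++; length-map; length-tabulate)
open import Data.List.Membership.Propositional using (_∈_; _∉_)
open import Data.List.Membership.Propositional.Properties
  using (∈-filter⁺; ∈-filter⁻; ∈-map⁺; ∈-map⁻; ∈-lookup; ∈-allFin
        ; ∈-cartesianProductWith⁺; ∈-cartesianProduct⁺; ∈-cartesianProduct⁻)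
import Data.List.Membership.Setoid.Properties as Membershipₛ
open import Data.List.Relation.Unary.All as All using (All; []; _∷_)
open import Data.List.Relation.Unary.Any as Any using (here; there)
open import Data.List.Relation.Unary.Unique.Propositional using (Unique; []; _∷_)
import Data.List.Relation.Unary.Unique.Propositional.Properties as Unique
open import Data.Nat
  using (ℕ; zero; suc; _+_; _*_; _∸_; _^_; _≤_; _<_; z≤n; s≤s; NonZero; >-nonZero; parity)
open import Data.Nat.Divisibility using (_∣_; divides; divides-refl)
open import Data.Nat.DivMod using (_%_; n%n≡0; m<n⇒m%n≡m; m%n<n)
open import Data.Nat.ListAction using (sum)
open import Data.Nat.Tactic.RingSolver using (solve-∀)
open import Data.Nat.Properties
open import Algebra.Properties.CommutativeSemigroup *-commutativeSemigroup
  using (xy∙z≈xz∙y)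
open import Data.Parity.Base as ℙ using (Parity; 0ℙ; 1ℙ)
import Data.Parity.Properties as ℙ
open import Data.Product using (_×_; _,_; ∃; ∃-syntax; proj₁; proj₂; swap; map; map₂)
open import Data.Rational as ℚ using (ℚ; 0ℚ)
import Data.Rational.Properties as ℚ
import Data.Rational.Unnormalised as ℚᵘ
import Data.Rational.Unnormalised.Properties as ℚᵘ
open import Data.Sum using (_⊎_; inj₁; inj₂; [_,_]′) renaming (map to ⊎-map)
open import Data.Vec as Vec using (Vec; []; _∷_; lookup; _++_; _∷ʳ_; replicate)
import Data.Vec.Properties as Vec
open import Function.Base using (_∘_; id; it)
open import Function.Definitions using (Injective)
open import Level using (0ℓ)
open import Relation.Binary using (Rel)
open import Relation.Binary.PropositionalEquality
open import Relation.Nullary using (¬_; Dec; yes; no; does; contradiction)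
open import Relation.Nullary.Decidable using (_⊎-dec_)
open import Relation.Unary using (Pred) renaming (Decidable to Decidable₁)

private
  variable
    A B C : Set
    k l m n : ℕ

-- Counting in lists without repetition.

-- Taking an index of `xs` to the position of its entry in `ys` is injective, because equal
-- positions hold equal entries and `xs` has no repetitions.
Unique-⊆⇒length≤ : {xs ys : List A} → Unique xs → (∀ {x} → x ∈ xs → x ∈ ys) →
                   length xs ≤ length ys
Unique-⊆⇒length≤ {A = A} {xs = xs} uniq xs⊆ys =
  Fin.injective⇒≤ {f = position} λ {i} {j} eq →
    lookup-injective uniq i j
      (Membershipₛ.index-injective (setoid A) _ _ eq)
  where
  position = λ i → Any.index (xs⊆ys (∈-lookup {xs = xs} i))

  lookup-injective : {xs : List A} → Unique xs → ∀ i j →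
                     List.lookup xs i ≡ List.lookup xs j → i ≡ j
  lookup-injective (_  ∷ _) zero    zero    _  = refl
  lookup-injective (x∉ ∷ _) zero    (suc j) eq = contradiction eq (All.lookup x∉ (∈-lookup j))
  lookup-injective (x∉ ∷ _) (suc i) zero    eq = contradiction (sym eq) (All.lookup x∉ (∈-lookup i))
  lookup-injective (_  ∷ u) (suc i) (suc j) eq = cong suc (lookup-injective u i j eq)

length-cartesianProductWith : (f : A → B → C) (xs : List A) (ys : List B) →
  length (List.cartesianProductWith f xs ys) ≡ length xs * length ys
length-cartesianProductWith f []       ys = refl
length-cartesianProductWith f (x ∷ xs) ys = trans
  (length-++ (List.map (f x) ys))
  (cong₂ _+_ (length-map (f x) ys) (length-cartesianProductWith f xs ys))

∈⇒≤sum : ∀ {x xs} → x ∈ xs → x ≤ sum xs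
∈⇒≤sum (here refl) = m≤m+n _ _
∈⇒≤sum (there x∈)  = ≤-trans (∈⇒≤sum x∈) (m≤n+m _ _)

∈-tuples : {xs : List A} → (∀ x → x ∈ xs) → (v : Vec A k) → v ∈ tuples xs k
∈-tuples all []      = here refl
∈-tuples all (x ∷ v) = ∈-cartesianProductWith⁺ _∷_ (all x) (∈-tuples all v)

∈-tuples-lookup : {xs : List A} (v : Vec A k) → (∀ i → lookup v i ∈ xs) → v ∈ tuples xs k
∈-tuples-lookup []      v∈ = here refl
∈-tuples-lookup (x ∷ v) v∈ =
  ∈-cartesianProductWith⁺ _∷_ (v∈ zero) (∈-tuples-lookup v (v∈ ∘ suc))

tuples-unique : {xs : List A} → Unique xs → ∀ k → Unique (tuples xs k)
tuples-unique u zero    = [] ∷ []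
tuples-unique u (suc k) =
  Unique.cartesianProductWith⁺ _∷_ (λ eq → Vec.∷-injective eq) u (tuples-unique u k)

length-tuples : (xs : List A) → ∀ k → length (tuples xs k) ≡ length xs ^ k
length-tuples xs zero    = refl
length-tuples xs (suc k) =
  trans (length-cartesianProductWith _∷_ xs (tuples xs k))
        (cong (length xs *_) (length-tuples xs k))

-- If `xs` held every element of `Fin n`, their positions would inject `Fin n` into
-- `Fin (length xs)`.
fresh : (xs : List (Fin n)) → length xs < n → ∃ (_∉ xs)
fresh {n} xs short = Fin.¬∀⟶∃¬ n (_∈ xs) (λ x → Any.any? (x Fin.≟_) xs) λ all →
  <⇒≱ short (Fin.injective⇒≤ {f = Any.index ∘ all}
    (Membershipₛ.index-injective (setoid (Fin n)) _ _))

-- Pigeonhole for parity patterns.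

parityFibres : (p : A → Parity) (xs : List A) →
  length xs ≤ length (filter (λ x → p x ℙ.≟ 0ℙ) xs) + length (filter (λ x → p x ℙ.≟ 1ℙ) xs)
parityFibres p []       = z≤n
parityFibres p (x ∷ xs) with p x
... | 0ℙ = s≤s (parityFibres p xs)
... | 1ℙ = ≤-trans (s≤s (parityFibres p xs)) (≤-reflexive (sym (+-suc _ _)))

AgreeOn : List (A → Parity) → List A → Set
AgreeOn ps ys = ∀ {p x y} → p ∈ ps → x ∈ ys → y ∈ ys → p x ≡ p y

-- The number l is separate from length ps so that it can remain a variable in
-- applications: 2 ^ (d * d) with d = 4 + j would be unfolded by the type checker.
parityPigeonhole : (ps : List (A → Parity)) → length ps ≡ l → {xs : List A} → Unique xs →
  ∃[ ys ] Unique ys × length xs ≤ 2 ^ l * length ys × AgreeOn ps ys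
parityPigeonhole []       refl {xs} u = xs , u , ≤-reflexive (sym (+-identityʳ _)) , λ ()
parityPigeonhole (p ∷ ps) refl {xs} u
  with ys , uys , bound , const ← parityPigeonhole ps refl u
  -- One more parity splits `ys` into two fibres, and keeping the larger loses at most a factor 2.
  = [ fibre 0ℙ , fibre 1ℙ ]′ larger
  where
  ys₀ = filter (λ x → p x ℙ.≟ 0ℙ) ys
  ys₁ = filter (λ x → p x ℙ.≟ 1ℙ) ys

  larger : length ys ≤ 2 * length ys₀ ⊎ length ys ≤ 2 * length ys₁
  larger with ≤-total (length ys₁) (length ys₀)
  ... | inj₁ le = inj₁ (≤-trans (parityFibres p ys)
                          (+-monoʳ-≤ (length ys₀) (≤-trans le (≤-reflexive (sym (+-identityʳ _))))))
  ... | inj₂ le = inj₂ (≤-trans (parityFibres p ys)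
                          (+-mono-≤ le (≤-reflexive (sym (+-identityʳ _)))))

  fibre : ∀ a → length ys ≤ 2 * length (filter (λ x → p x ℙ.≟ a) ys) →
          ∃[ zs ] Unique zs × length xs ≤ 2 ^ suc (length ps) * length zs × AgreeOn (p ∷ ps) zs
  fibre a half = zs , Unique.filter⁺ (λ x → p x ℙ.≟ a) uys , bound′ , const′
    where
    zs = filter (λ x → p x ℙ.≟ a) ys

    bound′ : length xs ≤ 2 ^ suc (length ps) * length zs
    bound′ = begin
      length xs                           ≤⟨ bound ⟩
      2 ^ length ps * length ys           ≤⟨ *-monoʳ-≤ (2 ^ length ps) half ⟩
      2 ^ length ps * (2 * length zs)     ≡⟨ *-assoc (2 ^ length ps) 2 _ ⟨
      2 ^ length ps * 2 * length zs       ≡⟨ cong (_* length zs) (*-comm (2 ^ length ps) 2) ⟩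
      2 ^ suc (length ps) * length zs     ∎
      where open ≤-Reasoning

    const′ : AgreeOn (p ∷ ps) zs
    const′ (here refl) x∈ y∈ = trans (proj₂ (∈-filter⁻ (λ x → p x ℙ.≟ a) {xs = ys} x∈))
                                     (sym (proj₂ (∈-filter⁻ (λ x → p x ℙ.≟ a) {xs = ys} y∈)))
    const′ (there q∈)  x∈ y∈ = const q∈ (proj₁ (∈-filter⁻ (λ x → p x ℙ.≟ a) {xs = ys} x∈))
                                        (proj₁ (∈-filter⁻ (λ x → p x ℙ.≟ a) {xs = ys} y∈))

-- Parities and traversal counts.

parity≡0⇒even : ∀ n → parity n ≡ 0ℙ → 2 ∣ n
parity≡0⇒even zero          _  = divides-refl 0
parity≡0⇒even (suc (suc n)) eq with divides q refl ← parity≡0⇒even n eq = divides-refl (suc q)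

even⇒parity≡0 : ∀ {n} → 2 ∣ n → parity n ≡ 0ℙ
even⇒parity≡0 (divides q refl) = trans (ℙ.*-homo-* q 2) (ℙ.*-zeroʳ (parity q))

parity≡⇒even-sum : ∀ m n → parity m ≡ parity n → 2 ∣ m + n
parity≡⇒even-sum m n eq = parity≡0⇒even (m + n)
  (trans (ℙ.+-homo-+ m n) (trans (cong (ℙ._+ parity n) eq) (ℙ.p+p≡0ℙ (parity n))))

module _ {P : Pred A 0ℓ} (P? : Decidable₁ P) where

  count-++ : (xs : Vec A m) (ys : Vec A n) →
             Vec.count P? (xs ++ ys) ≡ Vec.count P? xs + Vec.count P? ys
  count-++ []       ys = refl
  count-++ (x ∷ xs) ys with does (P? x)
  ... | true  = cong suc (count-++ xs ys)
  ... | false = count-++ xs ys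

  count-none : (∀ x → ¬ P x) → (xs : Vec A n) → Vec.count P? xs ≡ 0
  count-none none []       = refl
  count-none none (x ∷ xs) with P? x
  ... | yes px = contradiction px (none x)
  ... | no  _  = count-none none xs

count-map : {P : Pred A 0ℓ} (P? : Decidable₁ P) {Q : Pred B 0ℓ} (Q? : Decidable₁ Q) {f : B → A} →
            (∀ {x} → P (f x) → Q x) → (∀ {x} → Q x → P (f x)) →
            (xs : Vec B n) → Vec.count P? (Vec.map f xs) ≡ Vec.count Q? xs
count-map P? Q? to from []       = refl
count-map P? Q? {f} to from (x ∷ xs) with P? (f x) | Q? x
... | yes _ | yes _ = cong suc (count-map P? Q? to from xs)
... | yes p | no ¬q = contradiction (to p) ¬q
... | no ¬p | yes q = contradiction (from q) ¬p
... | no  _ | no  _ = count-map P? Q? to from xs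

-- Chains and their cyclic closure.

-- The vector holds only the interior points. With the endpoints as indices, a closed chain is one
-- whose indices coincide, and `x ∷ xs` lists its starting point just once.
data Chain (R : Rel A 0ℓ) : A → Vec A n → A → Set where
  [_] : ∀ {x y} → R x y → Chain R x [] y
  _∷_ : ∀ {x y z} {xs : Vec A n} → R x z → Chain R z xs y → Chain R x (z ∷ xs) y

module _ {R : Rel A 0ℓ} where

  Chain-++ : ∀ {x y z} {xs : Vec A m} {ys : Vec A n} →
             Chain R x xs y → Chain R y ys z → Chain R x (xs ++ y ∷ ys) z
  Chain-++ [ r ]    ds = r ∷ ds
  Chain-++ (r ∷ cs) ds = r ∷ Chain-++ cs ds

  Chain-lookup : ∀ {x y} {xs : Vec A n} → Chain R x xs y →
                 ∀ i → R (lookup (x ∷ xs) i) (lookup (xs ∷ʳ y) i)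
  Chain-lookup [ r ]    zero    = r
  Chain-lookup (r ∷ _)  zero    = r
  Chain-lookup (_ ∷ cs) (suc i) = Chain-lookup cs i

next-last : ∀ n → next (Fin.fromℕ n) ≡ zero
next-last n = Fin.toℕ-injective (begin
  toℕ (next (Fin.fromℕ n))             ≡⟨ Fin.toℕ-fromℕ< (m%n<n (suc (toℕ (Fin.fromℕ n))) (suc n)) ⟩
  suc (toℕ (Fin.fromℕ n)) % suc n ≡⟨ cong (λ t → suc t % suc n) (Fin.toℕ-fromℕ n) ⟩
  suc n % suc n           ≡⟨ n%n≡0 (suc n) ⟩
  0                                ∎)
  where open ≡-Reasoning

next-inject₁ : (i : Fin n) → next (inject₁ i) ≡ suc i
next-inject₁ {n} i = Fin.toℕ-injective (begin
  toℕ (next (inject₁ i))             ≡⟨ Fin.toℕ-fromℕ< (m%n<n (suc (toℕ (inject₁ i))) (suc n)) ⟩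
  suc (toℕ (inject₁ i)) % suc n ≡⟨ cong (λ t → suc t % suc n) (Fin.toℕ-inject₁ i) ⟩
  suc (toℕ i) % suc n       ≡⟨ m<n⇒m%n≡m (s≤s (Fin.toℕ<n i)) ⟩
  suc (toℕ i)                        ∎)
  where open ≡-Reasoning

lookup-∷ʳ-last : (xs : Vec A n) (x : A) → lookup (xs ∷ʳ x) (Fin.fromℕ n) ≡ x
lookup-∷ʳ-last []       x = refl
lookup-∷ʳ-last (y ∷ xs) x = lookup-∷ʳ-last xs x

lookup-∷ʳ-inject₁ : (xs : Vec A n) (x : A) (i : Fin n) → lookup (xs ∷ʳ x) (inject₁ i) ≡ lookup xs i
lookup-∷ʳ-inject₁ (y ∷ xs) x zero    = refl
lookup-∷ʳ-inject₁ (y ∷ xs) x (suc i) = lookup-∷ʳ-inject₁ xs x i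

-- The appended copy of `x` sits at the last index, which is where `next` wraps round to zero.
lookup-rotate : (x : A) (xs : Vec A n) (i : Fin (suc n)) →
                lookup (xs ∷ʳ x) i ≡ lookup (x ∷ xs) (next i)
lookup-rotate {n = n} x xs i with view i
... | ‵fromℕ     rewrite next-last n   = lookup-∷ʳ-last xs x
... | ‵inject₁ j rewrite next-inject₁ j = lookup-∷ʳ-inject₁ xs x j

-- `Chain-lookup` relates each entry to its successor in the shifted vector, and for equal endpoints
-- the shift is a rotation.
Chain-cyclic : {R : Rel A 0ℓ} {x : A} {xs : Vec A n} → Chain R x xs x →
               ∀ i → R (lookup (x ∷ xs) i) (lookup (x ∷ xs) (next i))
Chain-cyclic {R = R} {x} {xs} c i = subst (R _) (lookup-rotate x xs i) (Chain-lookup c i)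

length-allFin : ∀ n → length (List.allFin n) ≡ n
length-allFin n = length-tabulate {n = n} id

-- Closed walks in the complete graph.

-- Numbers the vertices other than `u` and `v`: the inner `punchIn` skips `v` as it appears within
-- the complement of `u`. These are the choices for extending a walk beyond the edge from `u` to
-- `v`.
pick : {u v : Fin (suc (suc k))} → u ≢ v → Fin k → Fin (suc (suc k))
pick {u = u} u≢v i = punchIn u (punchIn (punchOut u≢v) i)

pick≢ˡ : {u v : Fin (suc (suc k))} (u≢v : u ≢ v) (i : Fin k) → pick u≢v i ≢ u
pick≢ˡ {u = u} _ i = Fin.punchInᵢ≢i u _

pick≢ʳ : {u v : Fin (suc (suc k))} (u≢v : u ≢ v) (i : Fin k) → pick u≢v i ≢ v
pick≢ʳ {u = u} u≢v i eq = Fin.punchInᵢ≢i (punchOut u≢v) i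
  (Fin.punchIn-injective u _ _ (trans eq (sym (Fin.punchIn-punchOut u≢v))))

pick-injective : {u v : Fin (suc (suc k))} (u≢v : u ≢ v) {i j : Fin k} →
                 pick u≢v i ≡ pick u≢v j → i ≡ j
pick-injective {u = u} u≢v eq = Fin.punchIn-injective _ _ _ (Fin.punchIn-injective u _ _ eq)

-- The first component makes a closed chain also certify that all its darts are darts of the
-- complete graph.
Step : Rel (Dart n) 0ℓ
Step a b = tail a ≢ head a × head a ≡ tail b × b ≢ swap a

step : {x y z : Fin n} → x ≢ y → z ≢ x → Step (x , y) (y , z)
step x≢y z≢x = x≢y , refl , z≢x ∘ cong head

module CompleteWalks (j : ℕ) where

  d = 4 + j

  base : Dart d
  base = zero , suc zero

  -- Avoiding at most three vertices at a time is possible because d ≥ 4;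
  -- visiting 0 and 1 in the order 1, y₃, 0, 1 is what keeps it to three
  -- near the end of the path.
  return : {u v : Fin d} → u ≢ v → ∃[ q ] Chain Step {5} (u , v) q base
  return {u} {v} u≢v
    with y₁ , y₁∉ ← fresh (u ∷ v ∷ suc zero ∷ []) (s≤s (s≤s (s≤s (s≤s z≤n))))
    with y₂ , y₂∉ ← fresh (v ∷ y₁ ∷ suc zero ∷ []) (s≤s (s≤s (s≤s (s≤s z≤n))))
    with y₃ , y₃∉ ← fresh (y₂ ∷ suc zero ∷ zero ∷ []) (s≤s (s≤s (s≤s (s≤s z≤n))))
    = (v , y₁) ∷ (y₁ , y₂) ∷ (y₂ , suc zero) ∷ (suc zero , y₃) ∷ (y₃ , zero) ∷ []
    , step u≢v (y₁∉ ∘ here)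
    ∷ step (y₁∉ ∘ there ∘ here ∘ sym) (y₂∉ ∘ here)
    ∷ step (y₂∉ ∘ there ∘ here ∘ sym) (y₁∉ ∘ there ∘ there ∘ here ∘ sym)
    ∷ step (y₂∉ ∘ there ∘ there ∘ here) (y₃∉ ∘ here)
    ∷ step (y₃∉ ∘ there ∘ here ∘ sym) (λ ())
    ∷ [ step (y₃∉ ∘ there ∘ there ∘ here) (y₃∉ ∘ there ∘ here ∘ sym) ]

  -- Avoiding `v` gives a proper edge and avoiding `u` prevents backtracking, so every sequence of
  -- indices is allowed. The last 5 darts are those of `return`.
  walk : {u v : Fin d} → u ≢ v → Vec (Fin (2 + j)) m → Vec (Dart d) (m + 5)
  walk             u≢v []       = proj₁ (return u≢v)
  walk {v = v} u≢v (i ∷ is) = (v , pick u≢v i) ∷ walk (pick≢ʳ u≢v i ∘ sym) is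

  walk-chain : {u v : Fin d} (u≢v : u ≢ v) (is : Vec (Fin (2 + j)) m) →
               Chain Step (u , v) (walk u≢v is) base
  walk-chain u≢v []       = proj₂ (return u≢v)
  walk-chain u≢v (i ∷ is) = step u≢v (pick≢ˡ u≢v i) ∷ walk-chain _ is

  -- The head of each chosen dart reveals its index, as `pick` is injective; the remaining walks
  -- then start from the same edge.
  walk-injective : {u v : Fin d} (u≢v : u ≢ v) (is is′ : Vec (Fin (2 + j)) m) →
                   walk u≢v is ≡ walk u≢v is′ → is ≡ is′
  walk-injective u≢v []       []         _  = refl
  walk-injective u≢v (i ∷ is) (i′ ∷ is′) eq
    with same , rest ← Vec.∷-injective eq
    with refl ← pick-injective u≢v {i} {i′} (cong head same)
    = cong (i ∷_) (walk-injective _ is is′ rest)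

  0≢1 : _≢_ {A = Fin d} zero (suc zero)
  0≢1 ()

  loop : Vec (Fin (2 + j)) m → Vec (Dart d) (suc (m + 5))
  loop is = base ∷ walk 0≢1 is

  loop-injective : (is is′ : Vec (Fin (2 + j)) m) → loop is ≡ loop is′ → is ≡ is′
  loop-injective is is′ eq = walk-injective 0≢1 is is′ (Vec.∷-injectiveʳ eq)

  -- Parities are recorded for pairs of vertices of the complete graph rather than for edges of the
  -- ambient graph. This is what keeps the final constant independent of `G` and `n`.
  bits : List (Vec (Fin (2 + j)) m → Parity)
  bits = List.map (λ e is → parity (multiplicity e (loop is)))
                  (List.cartesianProduct (List.allFin d) (List.allFin d))

  length-bits : length (bits {m}) ≡ d * d
  length-bits = trans (length-map _ (List.cartesianProduct (List.allFin d) (List.allFin d)))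
    (trans (length-cartesianProductWith _,_ (List.allFin d) (List.allFin d))
           (cong₂ _*_ (length-allFin d) (length-allFin d)))

  -- Transport into the ambient graph.

  module InGraph (G : Graph n) (f : Fin d → Fin n) (f-inj : Injective _≡_ _≡_ f)
                 (f-adj : ∀ {u v} → u ≢ v → Adj G (f u) (f v)) where

    F : Dart d → Dart n
    F = map f f

    F-inj : Injective _≡_ _≡_ F
    F-inj eq = cong₂ _,_ (f-inj (cong proj₁ eq)) (f-inj (cong proj₂ eq))

    multiplicity-image : (e : Dart d) (w : Vec (Dart d) m) →
                         multiplicity (F e) (Vec.map F w) ≡ multiplicity e w
    multiplicity-image e = count-map
      (λ a → (a ≟ᵈ F e) ⊎-dec (a ≟ᵈ swap (F e))) (λ a → (a ≟ᵈ e) ⊎-dec (a ≟ᵈ swap e))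
      (⊎-map F-inj F-inj) (⊎-map (cong F) (cong F))

    multiplicity-nonimage : {e : Dart n} → ¬ (∃[ g ] F g ≡ e) → (w : Vec (Dart d) m) →
                            multiplicity e (Vec.map F w) ≡ 0
    multiplicity-nonimage {e = e} e∉F w = trans
      -- The image of `F` is closed under reversal, so if `e` lies outside it, neither orientation
      -- of `e` is traversed.
      (count-map _ (λ _ → no id) [ (λ eq → e∉F (_ , eq)) , (λ eq → e∉F (_ , cong swap eq)) ]′ (λ ()) w)
      (count-none _ (λ _ ()) w)

    image? : (e : Dart n) → Dec (∃[ g ] F g ≡ e)
    image? (p , q) with Fin.any? (λ u → f u Fin.≟ p) | Fin.any? (λ u → f u Fin.≟ q)
    ... | yes (u , eq) | yes (v , eq′) = yes ((u , v) , cong₂ _,_ eq eq′)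
    ... | no  ∄u       | _             = no λ (g , eq) → ∄u (proj₁ g , cong proj₁ eq)
    ... | yes _        | no  ∄v        = no λ (g , eq) → ∄v (proj₂ g , cong proj₂ eq)

    -- Agreement on pairs from the complete graph suffices: a dart outside the image is traversed
    -- zero times by both walks.
    parity-transfer : {w w′ : Vec (Dart d) m} →
                      (∀ g → parity (multiplicity g w) ≡ parity (multiplicity g w′)) →
                      ∀ e → parity (multiplicity e (Vec.map F w)) ≡ parity (multiplicity e (Vec.map F w′))
    parity-transfer {w = w} {w′} same e with image? e
    ... | yes (g , refl) rewrite multiplicity-image g w | multiplicity-image g w′ = same g
    ... | no e∉F rewrite multiplicity-nonimage e∉F w | multiplicity-nonimage e∉F w′ = refl

    closedWord : Vec (Fin (2 + j)) m × Vec (Fin (2 + j)) m → Vec (Dart n) (suc (m + 5) + suc (m + 5))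
    closedWord (is , is′) = Vec.map F (loop is ++ loop is′)

    map-injective : {xs ys : Vec (Dart d) m} → Vec.map F xs ≡ Vec.map F ys → xs ≡ ys
    map-injective {xs = []}     {[]}     _  = refl
    map-injective {xs = _ ∷ _} {_ ∷ _} eq =
      cong₂ _∷_ (F-inj (Vec.∷-injectiveˡ eq)) (map-injective (Vec.∷-injectiveʳ eq))

    -- Both loops have the fixed length `suc (m + 5)`, so the concatenation splits in only one way,
    -- and each half determines its indices.
    closedWord-injective : {p p′ : Vec (Fin (2 + j)) m × Vec (Fin (2 + j)) m} →
                           closedWord p ≡ closedWord p′ → p ≡ p′
    closedWord-injective {p = is , is′} {ks , ks′} eq
      with left , right ← Vec.++-injective (loop is) (loop ks) (map-injective eq)
      = cong₂ _,_ (loop-injective is ks left) (loop-injective is′ ks′ right)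

    -- Each walk chains from `base` back to `base`, so the junction and the cyclic closure are both
    -- legal steps.
    closedWord-steps : (is is′ : Vec (Fin (2 + j)) m) → ∀ i →
      Step (lookup (loop is ++ loop is′) i) (lookup (loop is ++ loop is′) (next i))
    closedWord-steps is is′ = Chain-cyclic (Chain-++ (walk-chain 0≢1 is) (walk-chain 0≢1 is′))

    closedWord∈walks : (p : Vec (Fin (2 + j)) m × Vec (Fin (2 + j)) m) →
                       closedWord p ∈ closedNBWalks G (suc (m + 5) + suc (m + 5))
    closedWord∈walks (is , is′) = ∈-filter⁺ closedNB? (∈-tuples-lookup _ dart∈) closed
      where
      w = loop is ++ loop is′

      dart∈ : ∀ i → lookup (Vec.map F w) i ∈ darts G
      dart∈ i rewrite Vec.lookup-map i F w =
        ∈-filter⁺ (λ e → adj? G (tail e) (head e))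
                  (∈-cartesianProduct⁺ (∈-allFin _) (∈-allFin _))
                  -- Distinct endpoints mean adjacency in the complete graph, which `f` preserves.
                  (f-adj (proj₁ (closedWord-steps is is′ i)))

      closed : ClosedNB (Vec.map F w)
      closed i rewrite Vec.lookup-map i F w | Vec.lookup-map (next i) F w
        with _ , glued , nb ← closedWord-steps is is′ i
        = cong f glued , nb ∘ F-inj

    -- Multiplicities add under concatenation, and two equal parities cancel.
    closedWord-even : {is is′ : Vec (Fin (2 + j)) m} →
      (∀ g → parity (multiplicity g (loop is)) ≡ parity (multiplicity g (loop is′))) →
      TotallyEven G (closedWord (is , is′))
    closedWord-even {is = is} {is′} same i = subst (2 ∣_) (sym split)
      (parity≡⇒even-sum (multiplicity e (Vec.map F (loop is))) _ (parity-transfer {w = loop is} {loop is′} same e))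
      where
      e = edge G i

      split : multiplicity e (closedWord (is , is′)) ≡
              multiplicity e (Vec.map F (loop is)) + multiplicity e (Vec.map F (loop is′))
      split = trans (cong (multiplicity e) (Vec.map-++ F (loop is) (loop is′)))
                    (count-++ (λ a → (a ≟ᵈ e) ⊎-dec (a ≟ᵈ swap e)) (Vec.map F (loop is)) (Vec.map F (loop is′)))

    -- The pigeonhole leaves a class of at least `N` divided by `2 ^ L` index sequences. All its
    -- ordered pairs give distinct totally even walks, hence the squares on both sides.
    pairs-bound : ∀ {L} → d * d ≡ L → ∀ m →
               (2 + j) ^ m * (2 + j) ^ m ≤ 2 ^ L * 2 ^ L * Ev G (suc (m + 5) + suc (m + 5))
    pairs-bound {L} d²≡L m
      with ys , uniq , bound , agree ←
        parityPigeonhole (bits {m}) (trans (length-bits {m}) d²≡L) (tuples-unique (Unique.allFin⁺ (2 + j)) m)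
      = begin
        N * N                                     ≤⟨ *-mono-≤ (bound′ ys bound) (bound′ ys bound) ⟩
        2 ^ L * length ys * (2 ^ L * length ys)   ≡⟨ [m*n]*[o*p]≡[m*o]*[n*p] (2 ^ L) (length ys) (2 ^ L) (length ys) ⟩
        2 ^ L * 2 ^ L * (length ys * length ys)   ≤⟨ *-monoʳ-≤ (2 ^ L * 2 ^ L) (pairs≤Ev ys uniq agree) ⟩
        2 ^ L * 2 ^ L * Ev G ℓ                    ∎
      where
      open ≤-Reasoning
      ℓ = suc (m + 5) + suc (m + 5)
      N = (2 + j) ^ m

      bound′ : (ys : List (Vec (Fin (2 + j)) m)) →
               length (tuples (List.allFin (2 + j)) m) ≤ 2 ^ L * length ys → N ≤ 2 ^ L * length ys
      bound′ ys = subst (_≤ 2 ^ L * length ys)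
        (trans (length-tuples (List.allFin (2 + j)) m) (cong (_^ m) (length-allFin (2 + j))))

      pairs≤Ev : (ys : List (Vec (Fin (2 + j)) m)) → Unique ys → AgreeOn bits ys →
                 length ys * length ys ≤ Ev G ℓ
      pairs≤Ev ys uniq agree = begin
        length ys * length ys                 ≡⟨ length-cartesianProductWith _,_ ys ys ⟨
        length pairs                          ≡⟨ length-map closedWord pairs ⟨
        length (List.map closedWord pairs)    ≤⟨ Unique-⊆⇒length≤
                                                   (Unique.map⁺ closedWord-injective
                                                     (Unique.cartesianProduct⁺ uniq uniq)) member ⟩
        Ev G ℓ                                ∎
        where
        pairs = List.cartesianProduct ys ys

        member : ∀ {w} → w ∈ List.map closedWord pairs →
                 w ∈ filter (totallyEven? G) (closedNBWalks G ℓ)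
        member w∈
          with (is , is′) , p∈ , refl ← ∈-map⁻ closedWord w∈
          with is∈ , is′∈ ← ∈-cartesianProduct⁻ ys ys p∈
          = ∈-filter⁺ (totallyEven? G) (closedWord∈walks (is , is′))
              (closedWord-even {is = is} {is′} λ (x , y) →
                agree (∈-map⁺ _ (∈-cartesianProduct⁺ (∈-allFin x) (∈-allFin y))) is∈ is′∈)

-- Comparison with the confined mass.

tabulate-const : (x : A) → Vec.tabulate {n = n} (λ _ → x) ≡ replicate n x
tabulate-const {n = zero}  x = refl
tabulate-const {n = suc n} x = cong (x ∷_) (tabulate-const x)

-- A subspace contains the zero vector, so `Nnb` at zero is one of the summands, and it counts every
-- totally even walk.
Ev≤confinedMass : (G : Graph n) (W : CycleSubspace G) → ∀ ℓ → Ev G ℓ ≤ confinedMass G W ℓ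
Ev≤confinedMass G W ℓ = ≤-trans
  (Unique-⊆⇒length≤ (Unique.filter⁺ (totallyEven? G) walks-unique) zero-parity)
  (∈⇒≤sum (∈-map⁺ (Nnb G ℓ) (∈-filter⁺ (mem? W) (∈-tuples parity∈ _) (0∈ W))))
  where
  walks-unique : Unique (closedNBWalks G ℓ)
  walks-unique = Unique.filter⁺ closedNB? (tuples-unique
    (Unique.filter⁺ _ (Unique.cartesianProduct⁺ (Unique.allFin⁺ _) (Unique.allFin⁺ _))) ℓ)

  parity∈ : ∀ p → p ∈ 0ℙ ∷ 1ℙ ∷ []
  parity∈ 0ℙ = here refl
  parity∈ 1ℙ = there (here refl)

  parityVec≡0 : (w : Vec (Dart _) ℓ) → TotallyEven G w → parityVec G w ≡ replicate _ 0ℙ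
  parityVec≡0 w even = trans (Vec.tabulate-cong (even⇒parity≡0 ∘ even)) (tabulate-const 0ℙ)

  zero-parity : ∀ {w} → w ∈ filter (totallyEven? G) (closedNBWalks G ℓ) →
                w ∈ filter (λ w → Vec.≡-dec ℙ._≟_ (parityVec G w) (replicate _ 0ℙ)) (closedNBWalks G ℓ)
  zero-parity {w} w∈ with w∈walks , even ← ∈-filter⁻ (totallyEven? G) {xs = closedNBWalks G ℓ} w∈
    = ∈-filter⁺ _ w∈walks (parityVec≡0 w even)

-- From integer to rational bounds.

-- Between unnormalised rationals the claim is a cross-multiplied integer inequality, and `toℚᵘ`
-- carries it over.
fraction-≤ : ∀ M .{{_ : NonZero M}} {x y} → x ≤ M * y →
             + 1 ℚ./ M ℚ.* fromℕ x ℚ.≤ fromℕ y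
fraction-≤ M@(suc M-1) {x} {y} x≤My = ℚ.toℚᵘ-cancel-≤ (begin
  ℚ.toℚᵘ (+ 1 ℚ./ M ℚ.* fromℕ x)                ≃⟨ ℚ.toℚᵘ-homo-* (+ 1 ℚ./ M) (fromℕ x) ⟩
  ℚ.toℚᵘ (+ 1 ℚ./ M) ℚᵘ.* ℚ.toℚᵘ (fromℕ x)      ≃⟨ ℚᵘ.*-cong (ℚ.toℚᵘ-fromℚᵘ (ℚᵘ.mkℚᵘ (+ 1) M-1))
                                                              (ℚ.toℚᵘ-fromℚᵘ (ℚᵘ.mkℚᵘ (+ x) 0)) ⟩
  ℚᵘ.mkℚᵘ (+ 1) M-1 ℚᵘ.* ℚᵘ.mkℚᵘ (+ x) 0        ≤⟨ ℚᵘ.*≤* cross ⟩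
  ℚᵘ.mkℚᵘ (+ y) 0                               ≃⟨ ℚ.toℚᵘ-fromℚᵘ (ℚᵘ.mkℚᵘ (+ y) 0) ⟨
  ℚ.toℚᵘ (fromℕ y)                              ∎)
  where
  open ℚᵘ.≤-Reasoning
  cross : + 1 ℤ.* + x ℤ.* + 1 ℤ.≤ + y ℤ.* (+ M ℤ.* + 1)
  cross = subst₂ ℤ._≤_
    (sym (trans (ℤ.*-identityʳ (+ 1 ℤ.* + x)) (ℤ.*-identityˡ (+ x))))
    (trans (cong +_ (*-comm M y)) (trans (ℤ.pos-* y M) (cong (λ z → + y ℤ.* z) (sym (ℤ.*-identityʳ (+ M))))))
    (ℤ.+≤+ x≤My)

-- Exponential growth against a logarithmic threshold.

^-distribʳ-* : ∀ x y n → (x * y) ^ n ≡ x ^ n * y ^ n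
^-distribʳ-* x y zero    = refl
^-distribʳ-* x y (suc n) = trans (cong (x * y *_) (^-distribʳ-* x y n))
                                 ([m*n]*[o*p]≡[m*o]*[n*p] x y (x ^ n) (y ^ n))

n<2^n : ∀ n → n < 2 ^ n
n<2^n zero    = s≤s z≤n
n<2^n (suc n) = +-mono-≤ (m^n>0 2 n) (≤-trans (n<2^n n) (m≤m+n (2 ^ n) 0))

-- Bernoulli's inequality (1 + 1/a)ⁿ ≥ 1 + n/a, cleared of denominators.
bernoulli : ∀ a n → a ^ n * (a + n) ≤ suc a ^ n * a
bernoulli a zero    = ≤-reflexive (cong (1 *_) (+-identityʳ a))
bernoulli a (suc n) = begin
  a * a ^ n * (a + suc n)               ≤⟨ m≤m+n _ (a ^ n * n) ⟩
  a * a ^ n * (a + suc n) + a ^ n * n   ≡⟨ rearrange a n (a ^ n) ⟩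
  suc a * (a ^ n * (a + n))             ≤⟨ *-monoʳ-≤ (suc a) (bernoulli a n) ⟩
  suc a * (suc a ^ n * a)               ≡⟨ *-assoc (suc a) (suc a ^ n) a ⟨
  suc a * suc a ^ n * a                 ∎
  where
  open ≤-Reasoning
  rearrange : ∀ a n p → a * p * (a + suc n) + p * n ≡ suc a * (p * (a + n))
  rearrange = solve-∀

-- Bernoulli's inequality at exponent `a`, with the common factor `a` cancelled.
2*a^a≤[1+a]^a : ∀ a .{{_ : NonZero a}} → 2 * a ^ a ≤ suc a ^ a
2*a^a≤[1+a]^a a = *-cancelʳ-≤ _ _ a (≤-trans (≤-reflexive (rearrange a (a ^ a))) (bernoulli a a))
  where
  rearrange : ∀ a p → 2 * p * a ≡ p * (a + a)
  rearrange = solve-∀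

-- If the conclusion failed, then taking a-th powers and using (D²)ᵃ ≥ 2 aᵃ
-- would give 2^ℓ ≤ (M n)^(2a), whereas (M²)ᵃ < 2 ^ (M²)ᵃ ≤ n ^ (M²)ᵃ.
exponential-gap : ∀ {D a M n ℓ E} .{{_ : NonZero a}} → 2 ≤ n → suc a ≤ D * D →
  D ^ ℓ ≤ M * E → n ^ ((M * M) ^ a + (a + a)) ≤ 2 ^ ℓ → n * n * a ^ ℓ < E * E
exponential-gap {D} {a} {M} {n} {ℓ} {E} 2≤n 1+a≤D² D^ℓ≤ME n^C≤2^ℓ = ≰⇒> λ E²≤ →
  -- `small` and `large` contradict each other once the positive factor `(a ^ a) ^ ℓ` is cancelled.
  <⇒≱ small (*-cancelʳ-≤ _ _ ((a ^ a) ^ ℓ) {{m^n≢0 (a ^ a) ℓ {{m^n≢0 a a}}}} (large E²≤))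
  where
  open ≤-Reasoning
  K = (M * M) ^ a

  instance
    n≢0 : NonZero n
    n≢0 = >-nonZero (≤-trans (s≤s z≤n) 2≤n)

  small : K * (n ^ a * n ^ a) < 2 ^ ℓ
  small = begin-strict
    K * (n ^ a * n ^ a)         <⟨ *-monoˡ-< (n ^ a * n ^ a)
                                     {{m*n≢0 _ _ {{m^n≢0 n a}} {{m^n≢0 n a}}}} (n<2^n K) ⟩
    2 ^ K * (n ^ a * n ^ a)     ≤⟨ *-monoˡ-≤ _ (^-monoˡ-≤ K 2≤n) ⟩
    n ^ K * (n ^ a * n ^ a)     ≡⟨ cong ((n ^ K) *_) (^-distribˡ-+-* n a a) ⟨
    n ^ K * n ^ (a + a)         ≡⟨ ^-distribˡ-+-* n K (a + a) ⟨
    n ^ (K + (a + a))           ≤⟨ n^C≤2^ℓ ⟩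
    2 ^ ℓ                       ∎

  swap-exponents : ∀ x → (x ^ a) ^ ℓ ≡ (x ^ ℓ) ^ a
  swap-exponents x = trans (^-*-assoc x a ℓ) (trans (cong (x ^_) (*-comm a ℓ)) (sym (^-*-assoc x ℓ a)))

  large : E * E ≤ n * n * a ^ ℓ → 2 ^ ℓ * (a ^ a) ^ ℓ ≤ K * (n ^ a * n ^ a) * (a ^ a) ^ ℓ
  large E²≤ = begin
    2 ^ ℓ * (a ^ a) ^ ℓ                       ≡⟨ ^-distribʳ-* 2 (a ^ a) ℓ ⟨
    (2 * a ^ a) ^ ℓ                           ≤⟨ ^-monoˡ-≤ ℓ (2*a^a≤[1+a]^a a) ⟩
    (suc a ^ a) ^ ℓ                           ≤⟨ ^-monoˡ-≤ ℓ (^-monoˡ-≤ a 1+a≤D²) ⟩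
    ((D * D) ^ a) ^ ℓ                         ≡⟨ swap-exponents (D * D) ⟩
    ((D * D) ^ ℓ) ^ a                         ≡⟨ cong (_^ a) (^-distribʳ-* D D ℓ) ⟩
    (D ^ ℓ * D ^ ℓ) ^ a                       ≤⟨ ^-monoˡ-≤ a (*-mono-≤ D^ℓ≤ME D^ℓ≤ME) ⟩
    (M * E * (M * E)) ^ a                     ≡⟨ cong (_^ a) ([m*n]*[o*p]≡[m*o]*[n*p] M E M E) ⟩
    (M * M * (E * E)) ^ a                     ≤⟨ ^-monoˡ-≤ a (*-monoʳ-≤ (M * M) E²≤) ⟩
    (M * M * (n * n * a ^ ℓ)) ^ a             ≡⟨ ^-distribʳ-* (M * M) _ a ⟩
    K * (n * n * a ^ ℓ) ^ a                   ≡⟨ cong (K *_) (^-distribʳ-* (n * n) (a ^ ℓ) a) ⟩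
    K * ((n * n) ^ a * (a ^ ℓ) ^ a)           ≡⟨ cong₂ (λ s t → K * (s * t)) (^-distribʳ-* n n a)
                                                       (sym (swap-exponents a)) ⟩
    K * (n ^ a * n ^ a * (a ^ a) ^ ℓ)         ≡⟨ *-assoc K _ _ ⟨
    K * (n ^ a * n ^ a) * (a ^ a) ^ ℓ         ∎

-- As the base is at least 2, `ℓ < c` would force `2 ^ ℓ < 2 ^ c ≤ n ^ c`. This turns the
-- logarithmic threshold into a numerical one.
logarithmic⇒≤ : ∀ {n c ℓ} → 2 ≤ n → n ^ c ≤ 2 ^ ℓ → c ≤ ℓ
logarithmic⇒≤ {n} {c} {ℓ} 2≤n n^c≤2^ℓ = ≮⇒≥ λ ℓ<c →
  <⇒≱ (<-≤-trans (^-monoʳ-< 2 (s≤s (s≤s z≤n)) ℓ<c) (^-monoˡ-≤ c 2≤n)) n^c≤2^ℓ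

-- Covering all even lengths.

-- Each of the two loops consists of `base`, `m` free steps and 5 returning darts; 12 is the total
-- length at `m` equal to 0.
even-split : ∀ {ℓ} → 2 ∣ ℓ → 12 ≤ ℓ → ∃[ m ] ℓ ≡ suc (m + 5) + suc (m + 5)
even-split (divides q refl) 12≤ with m≤n⇒∃[o]m+o≡n (*-cancelʳ-≤ 6 q 2 12≤)
... | m , refl = m , rearrange m
  where
  rearrange : ∀ m → (6 + m) * 2 ≡ suc (m + 5) + suc (m + 5)
  rearrange = solve-∀

-- The constant is produced before `E` is given, so it cannot depend on the graph. Its factor
-- `D ^ 12` makes up for the 12 darts that are not free choices.
evenLengths : ∀ D K .{{_ : NonZero D}} .{{_ : NonZero K}} →
  ∃[ M ] NonZero M × ((E : ℕ → ℕ) → (∀ m → D ^ m * D ^ m ≤ K * E (suc (m + 5) + suc (m + 5))) →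
                      ∀ {ℓ} → 2 ∣ ℓ → 12 ≤ ℓ → D ^ ℓ ≤ M * E ℓ)
evenLengths D K = K * D ^ 12 , m*n≢0 K (D ^ 12) {{it}} {{m^n≢0 D 12}} , extend
  where
  open ≤-Reasoning
  rearrange : ∀ m → suc (m + 5) + suc (m + 5) ≡ m + m + 12
  rearrange = solve-∀

  extend : (E : ℕ → ℕ) → (∀ m → D ^ m * D ^ m ≤ K * E (suc (m + 5) + suc (m + 5))) →
           ∀ {ℓ} → 2 ∣ ℓ → 12 ≤ ℓ → D ^ ℓ ≤ K * D ^ 12 * E ℓ
  extend E bound {ℓ} 2∣ℓ 12≤ℓ with m , ℓ≡ ← even-split 2∣ℓ 12≤ℓ = begin
    D ^ ℓ                                            ≡⟨ cong (D ^_) (trans ℓ≡ (rearrange m)) ⟩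
    D ^ (m + m + 12)                                 ≡⟨ ^-distribˡ-+-* D (m + m) 12 ⟩
    D ^ (m + m) * D ^ 12                             ≡⟨ cong (_* D ^ 12) (^-distribˡ-+-* D m m) ⟩
    D ^ m * D ^ m * D ^ 12                           ≤⟨ *-monoˡ-≤ (D ^ 12) (bound m) ⟩
    K * E (suc (m + 5) + suc (m + 5)) * D ^ 12       ≡⟨ cong (λ ℓ → K * E ℓ * D ^ 12) ℓ≡ ⟨
    K * E ℓ * D ^ 12                                 ≡⟨ xy∙z≈xz∙y K (E ℓ) (D ^ 12) ⟩
    K * D ^ 12 * E ℓ                                 ∎

-- Uniform constants and the conclusion.

Ev-lower : ∀ j {L} → (4 + j) * (4 + j) ≡ L → (G : Graph n) → complete (4 + j) ContainedIn G →
  ∀ m → (2 + j) ^ m * (2 + j) ^ m ≤ 2 ^ L * 2 ^ L * Ev G (suc (m + 5) + suc (m + 5))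
Ev-lower j d²≡L G (f , f-inj , f-adj) = CompleteWalks.InGraph.pairs-bound j G f f-inj f-adj d²≡L

evenWalkBound : ∀ j {L} → (4 + j) * (4 + j) ≡ L → ∃[ M ] NonZero M ×
  (∀ {n} (G : Graph n) → complete (4 + j) ContainedIn G →
   ∀ {ℓ} → 2 ∣ ℓ → 12 ≤ ℓ → (2 + j) ^ ℓ ≤ M * Ev G ℓ)
evenWalkBound j {L} d²≡L =
  map₂ (map₂ λ extend G K⊆G → extend (Ev G) (Ev-lower j d²≡L G K⊆G))
       (evenLengths (2 + j) (2 ^ L * 2 ^ L) {{_}} {{m*n≢0 (2 ^ L) (2 ^ L) {{m^n≢0 2 L}} {{m^n≢0 2 L}}}})

-- Abstract because M, once unfolded, is too large to normalise.
abstract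
  evenWalkConstant : ∀ j → ∃[ M ] NonZero M ×
    (∀ {n} (G : Graph n) → complete (4 + j) ContainedIn G →
     ∀ {ℓ} → 2 ∣ ℓ → 12 ≤ ℓ → (2 + j) ^ ℓ ≤ M * Ev G ℓ)
  evenWalkConstant j = evenWalkBound j refl

proposition13 : ∀ d → 4 ≤ d →
    (∃[ c ] 0ℚ ℚ.< c × ∃[ ℓ₀ ]
    (∀ n (G : Graph n) → Connected G → complete d ContainedIn G →
    ∀ ℓ → 2 ∣ ℓ → ℓ₀ ≤ ℓ →
    c ℚ.* fromℕ ((d ∸ 2) ^ ℓ) ℚ.≤ fromℕ (Ev G ℓ)))
    × ((d ∸ 2) > 1 ·√ (d ∸ 1) ^ 1)
    × (∃[ C ]
    (∀ n (G : Graph n) → Connected G → complete d ContainedIn G →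
    ∀ ℓ → 2 ∣ ℓ → ℓ ≥ C ·log₂ n →
    (Ev G ℓ > n ·√ (d ∸ 1) ^ ℓ)
    × (∀ (W : CycleSubspace G) → confinedMass G W ℓ > n ·√ (d ∸ 1) ^ ℓ)))
-- Matching on `4 ≤ d` writes `d` as `4 + j`, so that `d ∸ 2` and `d ∸ 1` compute to `2 + j` and
-- `3 + j`.
proposition13 (suc (suc (suc (suc j)))) (s≤s (s≤s (s≤s (s≤s z≤n)))) =
  ( + 1 ℚ./ M , ℚ.positive⁻¹ _ {{ℚ.normalize-pos 1 M}} , 12
  , λ n G _ K⊆G ℓ 2∣ℓ 12≤ℓ → fraction-≤ M (bound G K⊆G 2∣ℓ 12≤ℓ))
  , subst (_< (2 + j) * (2 + j)) (sym (trans (*-identityˡ _) (^-identityʳ (3 + j)))) a<D²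
  , C₀ , λ n G _ K⊆G ℓ 2∣ℓ n^C≤2^ℓ →
      let gap = Ev-gap G K⊆G 2∣ℓ n^C≤2^ℓ
      -- The comparison with the square root is stated in squared form, so the bound by the confined
      -- mass enters twice.
      in  gap , λ W → <-≤-trans gap (*-mono-≤ (Ev≤confinedMass G W ℓ) (Ev≤confinedMass G W ℓ))
  where
  M : ℕ
  M = proj₁ (evenWalkConstant j)

  instance
    M≢0 : NonZero M
    M≢0 = proj₁ (proj₂ (evenWalkConstant j))

  bound : (G : Graph n) → complete (4 + j) ContainedIn G →
          ∀ {ℓ} → 2 ∣ ℓ → 12 ≤ ℓ → (2 + j) ^ ℓ ≤ M * Ev G ℓ
  bound = proj₂ (proj₂ (evenWalkConstant j))

  a<D² : 3 + j < (2 + j) * (2 + j)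
  -- The square exceeds `4 + j` by `3 * j + j * j`, which vanishes for `d` equal to 4: there the
  -- strict inequality holds with a margin of exactly 1.
  a<D² = ≤-trans (m≤m+n (4 + j) (3 * j + j * j)) (≤-reflexive (expand j))
    where
    expand : ∀ j → 4 + j + (3 * j + j * j) ≡ (2 + j) * (2 + j)
    expand = solve-∀

  -- `C₁` is the exponent required by `exponential-gap` with `a = 3 + j`; the extra 12 in `C₀`
  -- ensures that `ℓ` is long enough for `bound`.
  C₁ C₀ : ℕ
  C₁ = (M * M) ^ (3 + j) + (3 + j + (3 + j))
  C₀ = 12 + C₁

  Ev-gap : (G : Graph n) → complete (4 + j) ContainedIn G →
           ∀ {ℓ} → 2 ∣ ℓ → ℓ ≥ C₀ ·log₂ n → Ev G ℓ > n ·√ (3 + j) ^ ℓ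
  Ev-gap {n} G K⊆G {ℓ} 2∣ℓ n^C≤2^ℓ = exponential-gap {D = 2 + j} {M = M} {ℓ = ℓ} 2≤n a<D²
    (bound G K⊆G 2∣ℓ (≤-trans (m≤m+n 12 C₁) (logarithmic⇒≤ {n} {C₀} {ℓ} 2≤n n^C≤2^ℓ)))
    (≤-trans (^-monoʳ-≤ n {{>-nonZero (≤-trans (s≤s z≤n) 2≤n)}} (m≤n+m C₁ 12)) n^C≤2^ℓ)
    where
    -- The vertices of the complete graph inject into those of `G`.
    2≤n : 2 ≤ n
    2≤n = ≤-trans (s≤s (s≤s z≤n)) (Fin.injective⇒≤ (proj₁ (proj₂ K⊆G)))
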